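{- Let $k\ge2$ be even, $\alpha_1,\dots,\alpha_k$ positive integers, $G=C(\alpha_1,\dots,\alpha_k)$, and let $m(G)$ be the number of distinct Laplacian eigenvalues of $G$. Then $k\le m(G)\le 2k-1$.
   Context: $C(\alpha_1,\dots,\alpha_k)$ is defined recursively by $C(\alpha_1)=\overline{K_{\alpha_1}}$ (edgeless graph) and $C(\alpha_1,\dots,\alpha_i)=\overline{C(\alpha_1,\dots,\alpha_{i-1})\cup K_{\alpha_i}}$ for $i=2,\dots,k$ (disjoint union, then complement). Equivalently for $k$ even, with $\pi_i$ the $\alpha_i$ vertices introduced at step $i$: $\pi_i$ is a clique for $i$ odd, independent for $i$ even, and for $i<j$ vertices of $\pi_i,\pi_j$ are adjacent iff $j$ is even. Laplacian eigenvalues are those of $L=D-A$. -}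

module Defs where

open import Algebra.Apartness.Bundles using (HeytingField; HeytingCommutativeRing)
open import Algebra.Bundles using (CommutativeRing)
open import Data.Bool.Base using (Bool; false; not; _∧_; if_then_else_)
open import Data.Fin.Base using (Fin; zero; inject₁; fromℕ; splitAt)
open import Data.Fin.Properties using (_≟_; injective⇒≤)
open import Data.Fin.Subset using (Subset; ∣_∣)
open import Data.Nat.Base as ℕ using (ℕ)
open import Data.Nat.Properties using (≤-antisym)
open import Data.Product.Base using (∃-syntax; _×_; proj₁; proj₂)
open import Data.Sum.Base using (_⊎_; inj₁; inj₂)
open import Data.Vec.Base using (tabulate)
open import Function.Base using (_∘_)
open import Level using (Level; _⊔_)
open import Relation.Binary.PropositionalEquality using (_≡_; _≢_; refl; sym; cong; cong₂)
open import Relation.Nullary.Decidable.Core using (yes; no; does; decidable-stable)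
open import Relation.Nullary.Negation.Core using (contradiction)

record Graph (n : ℕ) : Set where
  field
    adj        : Fin n → Fin n → Bool
    adj-sym    : ∀ i j → adj i j ≡ adj j i
    adj-irrefl : ∀ i → adj i i ≡ false

open Graph public

_≠ᵇ_ : ∀ {n} → Fin n → Fin n → Bool
i ≠ᵇ j = not (does (i ≟ j))

≠ᵇ-sym : ∀ {n} (i j : Fin n) → i ≠ᵇ j ≡ j ≠ᵇ i
≠ᵇ-sym i j with i ≟ j | j ≟ i
... | yes _ | yes _ = refl
... | no  _ | no  _ = refl
... | yes p | no ¬q = contradiction (sym p) ¬q
... | no ¬p | yes q = contradiction (sym q) ¬p

≠ᵇ-irrefl : ∀ {n} (i : Fin n) → i ≠ᵇ i ≡ false
≠ᵇ-irrefl i with i ≟ i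
... | yes _ = refl
... | no ¬p = contradiction refl ¬p

complete : ∀ n → Graph n
complete n = record
  { adj        = _≠ᵇ_
  ; adj-sym    = ≠ᵇ-sym
  ; adj-irrefl = ≠ᵇ-irrefl
  }

complement : ∀ {n} → Graph n → Graph n
complement G = record
  { adj        = λ i j → (i ≠ᵇ j) ∧ not (adj G i j)
  ; adj-sym    = λ i j → cong₂ (λ a b → a ∧ not b) (≠ᵇ-sym i j) (adj-sym G i j)
  ; adj-irrefl = λ i → cong (_∧ not (adj G i i)) (≠ᵇ-irrefl i)
  }

module _ {m n} (G : Graph m) (H : Graph n) where

  ∪-adj : Fin m ⊎ Fin n → Fin m ⊎ Fin n → Bool
  ∪-adj (inj₁ i) (inj₁ j) = adj G i j
  ∪-adj (inj₂ i) (inj₂ j) = adj H i j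
  ∪-adj (inj₁ _) (inj₂ _) = false
  ∪-adj (inj₂ _) (inj₁ _) = false

  ∪-adj-sym : ∀ x y → ∪-adj x y ≡ ∪-adj y x
  ∪-adj-sym (inj₁ i) (inj₁ j) = adj-sym G i j
  ∪-adj-sym (inj₂ i) (inj₂ j) = adj-sym H i j
  ∪-adj-sym (inj₁ _) (inj₂ _) = refl
  ∪-adj-sym (inj₂ _) (inj₁ _) = refl

  ∪-adj-irrefl : ∀ x → ∪-adj x x ≡ false
  ∪-adj-irrefl (inj₁ i) = adj-irrefl G i
  ∪-adj-irrefl (inj₂ i) = adj-irrefl H i

_∪_ : ∀ {m n} → Graph m → Graph n → Graph (m ℕ.+ n)
_∪_ {m} G H = record
  { adj        = λ i j → ∪-adj G H (splitAt m i) (splitAt m j)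
  ; adj-sym    = λ i j → ∪-adj-sym G H (splitAt m i) (splitAt m j)
  ; adj-irrefl = λ i → ∪-adj-irrefl G H (splitAt m i)
  }

degree : ∀ {n} → Graph n → Fin n → ℕ
degree {n} G i = ∣ neighbours ∣
  where
  neighbours : Subset n
  neighbours = tabulate (adj G i)

order : ∀ k → (Fin k → ℕ) → ℕ
order 0                   α = 0
order 1                   α = α zero
order (ℕ.suc k@(ℕ.suc _)) α = order k (α ∘ inject₁) ℕ.+ α (fromℕ k)

-- αᵢ is α at index i - 1.  The case k = 0 is only there to make C total.
C : ∀ k (α : Fin k → ℕ) → Graph (order k α)
C 0                   α = complete 0
C 1                   α = complement (complete (α zero))
C (ℕ.suc k@(ℕ.suc _)) α =
  complement (C k (α ∘ inject₁) ∪ complete (α (fromℕ k)))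

-- The standard library has no real numbers, so spectra are taken in an
-- arbitrary Heyting field of characteristic zero: a field given by an
-- apartness relation _#_, as ℝ and ℂ are constructively.  Classically
-- (taking _#_ to be inequality) every field is of this form.

module Spectrum {c ℓ₁ ℓ₂ : Level} (K : HeytingField c ℓ₁ ℓ₂) where

  open HeytingField K hiding (sym; refl)

  commutativeRing : CommutativeRing c ℓ₁
  commutativeRing = HeytingCommutativeRing.commutativeRing heytingCommutativeRing

  open import Algebra.Definitions.RawMonoid
    (CommutativeRing.+-rawMonoid commutativeRing) public
    using (sum) renaming (_×_ to _·_)

  CharacteristicZero : Set ℓ₂
  CharacteristicZero = ∀ n → (ℕ.suc n · 1#) # 0#

  Vector : ℕ → Set c
  Vector n = Fin n → Carrier

  Matrix : ℕ → Set c
  Matrix n = Fin n → Fin n → Carrier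

  _*ᵥ_ : ∀ {n} → Matrix n → Vector n → Vector n
  (M *ᵥ v) i = sum (λ j → M i j * v j)

  adjacencyMatrix : ∀ {n} → Graph n → Matrix n
  adjacencyMatrix G i j = if adj G i j then 1# else 0#

  degreeMatrix : ∀ {n} → Graph n → Matrix n
  degreeMatrix G i j = if does (i ≟ j) then degree G i · 1# else 0#

  laplacian : ∀ {n} → Graph n → Matrix n
  laplacian G i j = degreeMatrix G i j - adjacencyMatrix G i j

  NonZeroVector : ∀ {n} → Vector n → Set ℓ₂
  NonZeroVector v = ∃[ i ] v i # 0#

  IsEigenvalue : ∀ {n} → Matrix n → Carrier → Set (c ⊔ ℓ₁ ⊔ ℓ₂)
  IsEigenvalue M x = ∃[ v ] NonZeroVector v × (∀ i → (M *ᵥ v) i ≈ x * v i)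

  -- M has exactly m distinct eigenvalues; m is unique by
  -- distinctEigenvalues-unique below.
  record DistinctEigenvalues {n} (M : Matrix n) (m : ℕ) : Set (c ⊔ ℓ₁ ⊔ ℓ₂) where
    field
      eigenvalue   : Fin m → Carrier
      isEigenvalue : ∀ i → IsEigenvalue M (eigenvalue i)
      distinct     : ∀ i j → i ≢ j → eigenvalue i # eigenvalue j
      exhaustive   : ∀ x → IsEigenvalue M x → ∃[ i ] x ≈ eigenvalue i

  module _ {n} {M : Matrix n} where

    open DistinctEigenvalues

    distinctEigenvalues-≤ : ∀ {p q} → DistinctEigenvalues M p → DistinctEigenvalues M q → p ℕ.≤ q
    distinctEigenvalues-≤ {p} {q} P Q = injective⇒≤ f-injective
      where
      module K = CommutativeRing commutativeRing

      f : Fin p → Fin q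
      f i = proj₁ (exhaustive Q (eigenvalue P i) (isEigenvalue P i))

      f-≈ : ∀ i → eigenvalue P i ≈ eigenvalue Q (f i)
      f-≈ i = proj₂ (exhaustive Q (eigenvalue P i) (isEigenvalue P i))

      f-injective : ∀ {i j} → f i ≡ f j → i ≡ j
      f-injective {i} {j} eq = decidable-stable (i ≟ j) λ i≢j →
        #-irrefl
          (K.trans (f-≈ i) (K.trans (K.reflexive (cong (eigenvalue Q) eq)) (K.sym (f-≈ j))))
          (distinct P i j i≢j)

    distinctEigenvalues-unique : ∀ {p q} → DistinctEigenvalues M p → DistinctEigenvalues M q → p ≡ q
    distinctEigenvalues-unique P Q =
      ≤-antisym (distinctEigenvalues-≤ P Q) (distinctEigenvalues-≤ Q P)

{-# OPTIONS --safe #-}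

-- On vectors with coordinate sum zero, the Laplacian of the complement of a
-- graph G on n vertices is n - L(G), and the Laplacian of G ∪ H has the
-- eigenvalues of both parts together with 0.  Hence the eigenvalue set F of
-- C(α₁,…,αᵢ), of order Nᵢ, evolves by F ↦ {0} ∪ (Nᵢ - F), to which Nᵢ₋₁ is
-- added when αᵢ ≥ 2, starting from {0}.  Each step adds at most two values, and
-- at least one because F is bounded by Nᵢ₋₁ < Nᵢ.
module Submission where

open import Defs
open import Algebra.Apartness.Bundles using (HeytingField)
open import Algebra.Bundles using (CommutativeRing)
import Algebra.Apartness.Properties.HeytingCommutativeRing as HeytingProperties
import Algebra.Properties.Monoid.Mult as MonoidMult
import Algebra.Properties.Ring as RingProperties
import Algebra.Properties.Semiring.Sum as SemiringSum
open import Data.Bool.Base using (Bool; true; false; if_then_else_)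
open import Data.Fin.Base using (Fin; zero; suc; inject₁; fromℕ; splitAt; _↑ˡ_; _↑ʳ_)
import Data.Fin.Properties as Fin
open import Data.Fin.Subset using (∣_∣)
open import Data.List.Base using (List; []; _∷_; [_]; _++_; map; length; lookup; deduplicate)
open import Data.List.Properties using (length-map)
open import Data.List.Membership.Propositional using (_∈_)
open import Data.List.Membership.Propositional.Properties using (∈-map⁺; ∈-map⁻; ∈-++⁺ˡ; ∈-++⁻; ∈-lookup; ∈-deduplicate⁺; ∈-deduplicate⁻)
open import Data.List.Relation.Binary.Subset.Propositional using (_⊆_)
open import Data.List.Relation.Binary.Subset.Propositional.Properties using (All-resp-⊇)
open import Data.List.Relation.Unary.All as All using (All; []; _∷_)
import Data.List.Relation.Unary.All.Properties as All
open import Data.List.Relation.Unary.AllPairs using ([]; _∷_)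
open import Data.List.Relation.Unary.Any using (here; there; index)
open import Data.List.Relation.Unary.Any.Properties using (lookup-index)
open import Data.List.Relation.Unary.Unique.Propositional using (Unique)
open import Data.List.Relation.Unary.Unique.DecPropositional.Properties using (deduplicate-!)
open import Data.Nat.Base using (ℕ; zero; suc; _+_; _≤_; _<_; _*_; _∸_; z≤n; s≤s)
open import Data.Nat.Divisibility.Core using (_∣_)
import Data.Nat.Properties as ℕ
open import Data.Product.Base using (_×_; _,_; ∃-syntax; proj₁)
open import Data.Sum.Base using (_⊎_; inj₁; inj₂; [_,_]′)
open import Data.Vec.Base using (tabulate)
open import Function.Base using (_∘_)
open import Level using (_⊔_)
open import Relation.Binary.Definitions using (tri<; tri≈; tri>)
open import Relation.Binary.PropositionalEquality as ≡ using (_≡_; _≢_)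
import Relation.Binary.Reasoning.Setoid as SetoidReasoning
open import Relation.Nullary.Decidable.Core using (yes; no; does)
open import Relation.Nullary.Negation.Core using (¬_; contradiction)

-- Duplicate-free lists and split index sets

module _ {a} {A : Set a} where

  lookup-injective : {xs : List A} → Unique xs → ∀ i j → lookup xs i ≡ lookup xs j → i ≡ j
  lookup-injective (_ ∷ _)  zero    zero    _  = ≡.refl
  lookup-injective (p ∷ _)  zero    (suc j) eq = contradiction eq (All.lookup p (∈-lookup j))
  lookup-injective (p ∷ _)  (suc i) zero    eq = contradiction (≡.sym eq) (All.lookup p (∈-lookup i))
  lookup-injective (_ ∷ ps) (suc i) (suc j) eq = ≡.cong suc (lookup-injective ps i j eq)

  -- Sending each position of `xs` to a position of the same entry in `ys` is injective, because
  -- equal targets mean equal entries. Both bounds on the number of eigenvalues are counted this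
  -- way.
  unique-⊆⇒length≤ : {xs ys : List A} → Unique xs → xs ⊆ ys → length xs ≤ length ys
  unique-⊆⇒length≤ {xs} {ys} xs! xs⊆ys = Fin.injective⇒≤ f-injective
    where
    f : Fin (length xs) → Fin (length ys)
    f i = index (xs⊆ys (∈-lookup i))

    f-injective : ∀ {i j} → f i ≡ f j → i ≡ j
    f-injective {i} {j} eq = lookup-injective xs! i j
      (≡.trans (lookup-index (xs⊆ys (∈-lookup i)))
        (≡.trans (≡.cong (lookup ys) eq) (≡.sym (lookup-index (xs⊆ys (∈-lookup j))))))

↑-elim : ∀ {m n p} (P : Fin (m + n) → Set p) → (∀ i → P (i ↑ˡ n)) → (∀ j → P (m ↑ʳ j)) → ∀ i → P i
↑-elim {m} P l r i with splitAt m i in eq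
... | inj₁ j = ≡.subst P (Fin.splitAt⁻¹-↑ˡ eq) (l j)
... | inj₂ j = ≡.subst P (Fin.splitAt⁻¹-↑ʳ {m} eq) (r j)

map-∸-unique : ∀ {n xs} → All (_≤ n) xs → Unique xs → Unique (map (n ∸_) xs)
map-∸-unique []       []       = []
map-∸-unique (b ∷ bs) (p ∷ ps) =
  All.map⁺ (All.zipWith (λ (b′ , x≢y) eq → x≢y (ℕ.∸-cancelˡ-≡ b b′ eq)) (bs , p))
  ∷ map-∸-unique bs ps

-- Orders of the graphs `C` and lists of candidate eigenvalues

order-positive : ∀ k (α : Fin (suc k) → ℕ) → (∀ i → 1 ≤ α i) → 1 ≤ order (suc k) α
order-positive zero    α α≥1 = α≥1 zero
order-positive (suc k) α α≥1 =
  ℕ.≤-trans (order-positive k (α ∘ inject₁) (α≥1 ∘ inject₁)) (ℕ.m≤m+n _ _)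

order-< : ∀ k (α : Fin (suc (suc k)) → ℕ) → (∀ i → 1 ≤ α i) →
          order (suc k) (α ∘ inject₁) < order (suc (suc k)) α
order-< k α α≥1 = ℕ.m<m+n _ (α≥1 (fromℕ (suc k)))

-- The eigenvalues of `complete n` on vectors of coordinate sum zero. On a single vertex such a
-- vector vanishes, so `n` is listed only from 2 on.
cliqueEigenvalues : ℕ → List ℕ
cliqueEigenvalues 0               = []
cliqueEigenvalues 1               = []
cliqueEigenvalues n@(suc (suc _)) = [ n ]

-- The eigenvalues of C k α that have an eigenvector of coordinate sum zero.
eigenvalues : ∀ k → (Fin k → ℕ) → List ℕ
eigenvalues 0               α = []
eigenvalues 1               α = map (α zero ∸_) (cliqueEigenvalues (α zero))
eigenvalues (suc k@(suc _)) α =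
  map (order (suc k) α ∸_) (0 ∷ eigenvalues k (α ∘ inject₁) ++ cliqueEigenvalues (α (fromℕ k)))

-- The eigenvalues present whatever the sizes of the parts: clique eigenvalues are left out, and
-- each step contributes one value.
lowerEigenvalues : ∀ k → (Fin k → ℕ) → List ℕ
lowerEigenvalues 0               α = []
lowerEigenvalues 1               α = [ 0 ]
lowerEigenvalues (suc k@(suc _)) α =
  0 ∷ map (order (suc k) α ∸_) (lowerEigenvalues k (α ∘ inject₁))

-- The second entry is the new order minus the clique eigenvalue `α (fromℕ k)`. It is listed even
-- for a part of size 1, so the length depends on `k` alone; repetitions are allowed.
upperEigenvalues : ∀ k → (Fin k → ℕ) → List ℕ
upperEigenvalues 0               α = []
upperEigenvalues 1               α = [ 0 ]
upperEigenvalues (suc k@(suc _)) α =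
  0 ∷ order k (α ∘ inject₁) ∷ map (order (suc k) α ∸_) (upperEigenvalues k (α ∘ inject₁))

∈-cliqueEigenvalues : ∀ n {x} → x ∈ cliqueEigenvalues n → x ≡ n
∈-cliqueEigenvalues (suc (suc _)) (here eq) = eq

length-lowerEigenvalues : ∀ k (α : Fin (suc k) → ℕ) → length (lowerEigenvalues (suc k) α) ≡ suc k
length-lowerEigenvalues zero    α = ≡.refl
length-lowerEigenvalues (suc k) α =
  ≡.cong suc (≡.trans (length-map _ (lowerEigenvalues (suc k) (α ∘ inject₁))) (length-lowerEigenvalues k (α ∘ inject₁)))

length-upperEigenvalues : ∀ k (α : Fin (suc k) → ℕ) → length (upperEigenvalues (suc k) α) ≡ 2 * suc k ∸ 1
length-upperEigenvalues zero    α = ≡.refl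
length-upperEigenvalues (suc k) α = begin
  2 + length (map _ (upperEigenvalues (suc k) (α ∘ inject₁)))  ≡⟨ ≡.cong (2 +_) (length-map _ (upperEigenvalues (suc k) (α ∘ inject₁))) ⟩
  2 + length (upperEigenvalues (suc k) (α ∘ inject₁))          ≡⟨ ≡.cong (2 +_) (length-upperEigenvalues k (α ∘ inject₁)) ⟩
  -- `2 * suc k ∸ 1` reduces to `k + (suc k + 0)`, so adding 2 gives this term by computation. The
  -- final term is likewise the value of `2 * suc (suc k) ∸ 1`.
  suc (suc k + (suc k + 0))                                    ≡⟨ ℕ.+-suc (suc k) (suc k + 0) ⟨
  suc k + suc (suc k + 0)                                      ∎
  where open ≡.≡-Reasoning

lowerEigenvalues-bounded : ∀ k (α : Fin (suc k) → ℕ) → All (_≤ order (suc k) α) (lowerEigenvalues (suc k) α)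
lowerEigenvalues-bounded zero    α = z≤n ∷ []
lowerEigenvalues-bounded (suc k) α =
  z≤n ∷ All.map⁺ (All.universal (λ x → ℕ.m∸n≤m _ x) _)

-- Earlier values are at most the previous order, which is strictly below the new one since the
-- added part is nonempty. Reflection therefore keeps them distinct and makes them positive, so the
-- new 0 is fresh.
lowerEigenvalues-unique : ∀ k (α : Fin (suc k) → ℕ) → (∀ i → 1 ≤ α i) → Unique (lowerEigenvalues (suc k) α)
lowerEigenvalues-unique zero    α α≥1 = [] ∷ []
lowerEigenvalues-unique (suc k) α α≥1 =
  All.map⁺ (All.map (λ x<n 0≡ → ℕ.<⇒≢ (ℕ.m<n⇒0<n∸m x<n) 0≡) bounded)
  ∷ map-∸-unique (All.map ℕ.<⇒≤ bounded) (lowerEigenvalues-unique k (α ∘ inject₁) (α≥1 ∘ inject₁))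
  where
  bounded : All (_< order (suc (suc k)) α) (lowerEigenvalues (suc k) (α ∘ inject₁))
  bounded = All.map (λ x≤n → ℕ.≤-<-trans x≤n (order-< k α α≥1)) (lowerEigenvalues-bounded k (α ∘ inject₁))

-- The 0 in front belongs to the constant vector. It also makes the induction fit, since the
-- recursive clause of `eigenvalues` reflects a list that starts with this same 0.
lowerEigenvalues-⊆ : ∀ k (α : Fin (suc k) → ℕ) →
                     lowerEigenvalues (suc k) α ⊆ 0 ∷ eigenvalues (suc k) α
lowerEigenvalues-⊆ zero    α (here eq) = here eq
lowerEigenvalues-⊆ (suc k) α (here eq) = here eq
lowerEigenvalues-⊆ (suc k) α (there x∈) with ∈-map⁻ _ x∈
... | _ , y∈ , ≡.refl = there (∈-map⁺ _ (∈-++⁺ˡ (lowerEigenvalues-⊆ k (α ∘ inject₁) y∈)))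

⊆-upperEigenvalues : ∀ k (α : Fin (suc k) → ℕ) →
                     0 ∷ eigenvalues (suc k) α ⊆ upperEigenvalues (suc k) α
⊆-upperEigenvalues zero    α (here eq) = here eq
⊆-upperEigenvalues (suc k) α (here eq) = here eq
⊆-upperEigenvalues zero    α (there x∈) with ∈-map⁻ _ x∈
-- In the edgeless graph the clique eigenvalue reflects to 0 and so merges with the constant
-- vector's eigenvalue: hence 1 value, not 2, at the first step.
... | y , y∈ , ≡.refl with ≡.refl ← ∈-cliqueEigenvalues (α zero) y∈ = here (ℕ.n∸n≡0 y)
⊆-upperEigenvalues (suc k) α (there x∈)
  with ∈-map⁻ (order (suc (suc k)) α ∸_)
         {xs = 0 ∷ eigenvalues (suc k) (α ∘ inject₁) ++ cliqueEigenvalues (α (fromℕ (suc k)))} x∈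
... | y , y∈ , ≡.refl with ∈-++⁻ (0 ∷ eigenvalues (suc k) (α ∘ inject₁)) y∈
...   | inj₁ y∈′ = there (there (∈-map⁺ _ (⊆-upperEigenvalues k (α ∘ inject₁) y∈′)))
...   | inj₂ y∈′ with ≡.refl ← ∈-cliqueEigenvalues (α (fromℕ (suc k))) y∈′ =
  there (here (ℕ.m+n∸n≡m (order (suc k) (α ∘ inject₁)) y))

module _ {c ℓ₁ ℓ₂} (K : HeytingField c ℓ₁ ℓ₂) where

  open Spectrum K
  open HeytingField K using (_#_; #-sym; #-cotrans; #-irrefl; tight; #⇒invertible; heytingCommutativeRing)
  open HeytingProperties heytingCommutativeRing using (1#0; x-0≈x; #-congʳ; #-congˡ; invertibleˡ⇒#)
  open CommutativeRing commutativeRing hiding (zero) renaming (_+_ to _⊕_; _*_ to _⊗_)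
  open RingProperties ring
  open MonoidMult +-monoid using (×-congˡ; ×-homo-+)
  open SemiringSum semiring hiding (sum)
  open SetoidReasoning setoid

  ι : ℕ → Carrier
  ι n = n · 1#

  ⟦_⟧_ : Bool → Carrier → Carrier
  ⟦ b ⟧ x = if b then x else 0#

  x-y+y≈x : ∀ x y → x - y ⊕ y ≈ x
  x-y+y≈x x y = //-rightDividesˡ y x

  x+y≈z⇒x≈z-y : ∀ {x y z} → x ⊕ y ≈ z → x ≈ z - y
  x+y≈z⇒x≈z-y {x} {y} {z} eq = trans (sym (//-rightDividesʳ y x)) (+-congʳ eq)

  -- Apartness in a Heyting field

  x-y#0⇒x#y : ∀ {x y} → x - y # 0# → x # y
  x-y#0⇒x#y {x} {y} x-y#0 with u , u[x-y-0]≈1 , _ ← #⇒invertible x-y#0 =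
    invertibleˡ⇒# (u , trans (*-congˡ (sym (x-0≈x (x - y)))) u[x-y-0]≈1)

  x#y⇒x-y#0 : ∀ {x y} → x # y → x - y # 0#
  x#y⇒x-y#0 {x} {y} x#y with u , u[x-y]≈1 , _ ← #⇒invertible x#y =
    invertibleˡ⇒# (u , trans (*-congˡ (x-0≈x (x - y))) u[x-y]≈1)

  x#y⇒z-y#z-x : ∀ z {x y} → x # y → z - y # z - x
  x#y⇒z-y#z-x z {x} {y} x#y = x-y#0⇒x#y (#-congʳ (sym eq) (x#y⇒x-y#0 x#y))
    where
    eq : (z - y) - (z - x) ≈ x - y
    eq = begin
      (z - y) - (z - x)    ≈⟨ +-congˡ (⁻¹-anti-homo-// z x) ⟩
      (z - y) ⊕ (x - z)    ≈⟨ +-comm _ _ ⟩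
      (x - z) ⊕ (z - y)    ≈⟨ +-assoc _ _ _ ⟨
      (x - z) ⊕ z - y      ≈⟨ +-congʳ (x-y+y≈x x z) ⟩
      x - y                ∎

  -- Multiply by the inverse of `x - y`. This is how eigenvectors, or their coordinate sums, are
  -- shown to vanish.
  x#y∧xz≈yz⇒z≈0 : ∀ {x y z} → x # y → x ⊗ z ≈ y ⊗ z → z ≈ 0#
  x#y∧xz≈yz⇒z≈0 {x} {y} {z} x#y xz≈yz with u , u[x-y]≈1 , _ ← #⇒invertible x#y = begin
    z                  ≈⟨ *-identityˡ z ⟨
    1# ⊗ z             ≈⟨ *-congʳ u[x-y]≈1 ⟨
    u ⊗ (x - y) ⊗ z    ≈⟨ *-assoc _ _ _ ⟩
    u ⊗ ((x - y) ⊗ z)  ≈⟨ *-congˡ ([y-z]x≈yx-zx z x y) ⟩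
    u ⊗ (x ⊗ z - y ⊗ z) ≈⟨ *-congˡ (x≈y⇒x∙y⁻¹≈ε xz≈yz) ⟩
    u ⊗ 0#             ≈⟨ zeroʳ u ⟩
    0#                 ∎

  -- Sums and Laplacians

  sum-zero : ∀ {n} {v : Vector n} → (∀ i → v i ≈ 0#) → sum v ≈ 0#
  sum-zero {n} v≈0 = trans (sum-cong-≋ v≈0) (sum-replicate-zero n)

  sum-constant : ∀ n x → sum {n} (λ _ → x) ≈ ι n ⊗ x
  sum-constant n x = begin
    sum {n} (λ _ → x)         ≈⟨ sum-cong-≋ {n} (λ _ → *-identityˡ x) ⟨
    sum {n} (λ _ → 1# ⊗ x)    ≈⟨ *-distribʳ-sum {n} x (λ _ → 1#) ⟨
    sum {n} (λ _ → 1#) ⊗ x    ≈⟨ *-congʳ (sum-replicate n) ⟩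
    ι n ⊗ x                   ∎

  sum-↑ : ∀ m {n} (v : Vector (m + n)) → sum v ≈ sum (v ∘ (_↑ˡ n)) ⊕ sum (v ∘ (m ↑ʳ_))
  sum-↑ zero    v = sym (+-identityˡ _)
  sum-↑ (suc m) v = trans (+-congˡ (sum-↑ m (v ∘ suc))) (sym (+-assoc _ _ _))

  sum-diagonal : ∀ {n} (i : Fin n) x (v : Vector n) →
                 sum (λ j → (if does (i Fin.≟ j) then x else 0#) ⊗ v j) ≈ x ⊗ v i
  sum-diagonal zero x v =
    trans (+-congˡ (sum-zero (λ j → zeroˡ (v (suc j))))) (+-identityʳ _)
  sum-diagonal (suc i) x v =
    trans (+-cong (zeroˡ _) (sum-diagonal i x (v ∘ suc))) (+-identityˡ _)

  sum-indicator : ∀ {n} (f : Fin n → Bool) x → ι ∣ tabulate f ∣ ⊗ x ≈ sum (λ j → ⟦ f j ⟧ x)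
  sum-indicator {zero}  f x = zeroˡ x
  sum-indicator {suc n} f x with f zero
  ... | true  = trans (distribʳ _ _ _) (+-cong (*-identityˡ x) (sum-indicator (f ∘ suc) x))
  ... | false = trans (sum-indicator (f ∘ suc) x) (sym (+-identityˡ _))

  ⟦⟧-* : ∀ b x → ⟦ b ⟧ 1# ⊗ x ≈ ⟦ b ⟧ x
  ⟦⟧-* true  x = *-identityˡ x
  ⟦⟧-* false x = zeroˡ x

  ⟦⟧-‿+ : ∀ b x y → ⟦ b ⟧ (x - y) ⊕ ⟦ b ⟧ y ≈ ⟦ b ⟧ x
  ⟦⟧-‿+ true  x y = x-y+y≈x x y
  ⟦⟧-‿+ false x y = +-identityʳ 0#

  -- The Laplacian as a difference operator. Without degrees, complements and unions can be treated
  -- summand by summand.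
  lap : ∀ {n} → Graph n → Vector n → Vector n
  lap G v i = sum (λ j → ⟦ adj G i j ⟧ (v i - v j))

  lap-+ : ∀ {n} (G : Graph n) v i →
          lap G v i ⊕ sum (λ j → ⟦ adj G i j ⟧ v j) ≈ sum (λ j → ⟦ adj G i j ⟧ v i)
  lap-+ G v i = trans (sym (∑-distrib-+ _ (λ j → ⟦ adj G i j ⟧ v j)))
    (sum-cong-≋ λ j → ⟦⟧-‿+ (adj G i j) (v i) (v j))

  -- Adding the neighbour sum of `v` to either side leaves the degree of `i` times `v i`.
  laplacian≈lap : ∀ {n} (G : Graph n) v i → (laplacian G *ᵥ v) i ≈ lap G v i
  laplacian≈lap G v i = +-cancelʳ (sum A) _ _ (begin
    (laplacian G *ᵥ v) i ⊕ sum A                              ≈⟨ ∑-distrib-+ _ A ⟨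
    sum (λ j → laplacian G i j ⊗ v j ⊕ A j)                   ≈⟨ sum-cong-≋ step ⟩
    sum (λ j → degreeMatrix G i j ⊗ v j)                      ≈⟨ sum-diagonal i _ v ⟩
    ι (degree G i) ⊗ v i                                      ≈⟨ sum-indicator (adj G i) (v i) ⟩
    sum (λ j → ⟦ adj G i j ⟧ v i)                             ≈⟨ lap-+ G v i ⟨
    lap G v i ⊕ sum A                                         ∎)
    where
    A : Vector _
    A j = ⟦ adj G i j ⟧ v j

    step : ∀ j → laplacian G i j ⊗ v j ⊕ A j ≈ degreeMatrix G i j ⊗ v j
    step j = begin
      laplacian G i j ⊗ v j ⊕ A j                              ≈⟨ +-congˡ (⟦⟧-* (adj G i j) (v j)) ⟨
      laplacian G i j ⊗ v j ⊕ adjacencyMatrix G i j ⊗ v j      ≈⟨ distribʳ _ _ _ ⟨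
      (laplacian G i j ⊕ adjacencyMatrix G i j) ⊗ v j          ≈⟨ *-congʳ (x-y+y≈x _ _) ⟩
      degreeMatrix G i j ⊗ v j                                 ∎

  -- Exchanging the two summations and using the symmetry of adjacency identifies the total of the
  -- terms `v j` with that of the terms `v i`, so they cancel.
  sum-lap : ∀ {n} (G : Graph n) v → sum (lap G v) ≈ 0#
  sum-lap {n} G v = +-cancelʳ F _ _ (begin
    sum (lap G v) ⊕ F                                    ≈⟨ +-congˡ (∑-comm {n} {n} _) ⟩
    sum (lap G v) ⊕ sum (λ i → sum (λ j → ⟦ adj G j i ⟧ v j))
      ≈⟨ +-congˡ (sum-cong-≋ λ i → sum-cong-≋ λ j → reflexive (≡.cong (⟦_⟧ v j) (adj-sym G j i))) ⟩
    sum (lap G v) ⊕ sum (λ i → sum (λ j → ⟦ adj G i j ⟧ v j))  ≈⟨ ∑-distrib-+ (lap G v) _ ⟨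
    sum (λ i → lap G v i ⊕ sum (λ j → ⟦ adj G i j ⟧ v j))      ≈⟨ sum-cong-≋ (lap-+ G v) ⟩
    F                                                    ≈⟨ +-identityˡ F ⟨
    0# ⊕ F                                               ∎)
    where
    F = sum (λ i → sum (λ j → ⟦ adj G i j ⟧ v i))

  sum-differences : ∀ {n} (v : Vector n) i → sum (λ j → v i - v j) ⊕ sum v ≈ ι n ⊗ v i
  sum-differences {n} v i = begin
    sum (λ j → v i - v j) ⊕ sum v    ≈⟨ ∑-distrib-+ _ v ⟨
    sum (λ j → v i - v j ⊕ v j)      ≈⟨ sum-cong-≋ (λ j → x-y+y≈x (v i) (v j)) ⟩
    sum {n} (λ j → v i)              ≈⟨ sum-constant n (v i) ⟩
    ι n ⊗ v i                        ∎

  lap-complete : ∀ {n} (v : Vector n) i → lap (complete n) v i ⊕ sum v ≈ ι n ⊗ v i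
  lap-complete v i = trans (+-congʳ (sum-cong-≋ off-diagonal)) (sum-differences v i)
    where
    off-diagonal : ∀ j → ⟦ i ≠ᵇ j ⟧ (v i - v j) ≈ v i - v j
    off-diagonal j with i Fin.≟ j
    ... | yes ≡.refl = sym (-‿inverseʳ (v i))
    ... | no  _      = refl

  -- Distinct vertices are adjacent in exactly one of the two graphs and diagonal terms vanish, so
  -- the Laplacians add up to `n I - J` with `J` the all-ones matrix; `sum v` is the `J` term moved
  -- across.
  lap-complement : ∀ {n} (G : Graph n) v i → lap (complement G) v i ⊕ lap G v i ⊕ sum v ≈ ι n ⊗ v i
  lap-complement {n} G v i = begin
    lap (complement G) v i ⊕ lap G v i ⊕ sum v   ≈⟨ +-congʳ (∑-distrib-+ _ (λ j → ⟦ adj G i j ⟧ (v i - v j))) ⟨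
    sum (λ j → ⟦ adj (complement G) i j ⟧ (v i - v j) ⊕ ⟦ adj G i j ⟧ (v i - v j)) ⊕ sum v
      ≈⟨ +-congʳ (sum-cong-≋ both) ⟩
    sum (λ j → v i - v j) ⊕ sum v                ≈⟨ sum-differences v i ⟩
    ι n ⊗ v i                                    ∎
    where
    both : ∀ j → ⟦ adj (complement G) i j ⟧ (v i - v j) ⊕ ⟦ adj G i j ⟧ (v i - v j) ≈ v i - v j
    both j with i Fin.≟ j | adj G i j in eq
    ... | yes ≡.refl | true  = contradiction (≡.trans (≡.sym eq) (adj-irrefl G i)) λ ()
    ... | yes ≡.refl | false = trans (+-identityˡ 0#) (sym (-‿inverseʳ (v i)))
    ... | no  _      | true  = +-identityˡ _
    ... | no  _      | false = +-identityʳ _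

  module _ {m n} (G : Graph m) (H : Graph n) (v : Vector (m + n)) where

    lap-∪ˡ : ∀ i → lap (G ∪ H) v (i ↑ˡ n) ≈ lap G (v ∘ (_↑ˡ n)) i
    lap-∪ˡ i rewrite Fin.splitAt-↑ˡ m i n = begin
      sum (λ j → ⟦ ∪-adj G H (inj₁ i) (splitAt m j) ⟧ (v (i ↑ˡ n) - v j))  ≈⟨ sum-↑ m _ ⟩
      _  ≈⟨ +-cong
             (sum-cong-≋ λ j → reflexive (≡.cong (λ z → ⟦ ∪-adj G H (inj₁ i) z ⟧ (v (i ↑ˡ n) - v (j ↑ˡ n))) (Fin.splitAt-↑ˡ m j n)))
             (sum-zero λ j → reflexive (≡.cong (λ z → ⟦ ∪-adj G H (inj₁ i) z ⟧ (v (i ↑ˡ n) - v (m ↑ʳ j))) (Fin.splitAt-↑ʳ m n j))) ⟩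
      lap G (v ∘ (_↑ˡ n)) i ⊕ 0#   ≈⟨ +-identityʳ _ ⟩
      lap G (v ∘ (_↑ˡ n)) i        ∎

    lap-∪ʳ : ∀ i → lap (G ∪ H) v (m ↑ʳ i) ≈ lap H (v ∘ (m ↑ʳ_)) i
    lap-∪ʳ i rewrite Fin.splitAt-↑ʳ m n i = begin
      sum (λ j → ⟦ ∪-adj G H (inj₂ i) (splitAt m j) ⟧ (v (m ↑ʳ i) - v j))  ≈⟨ sum-↑ m _ ⟩
      _  ≈⟨ +-cong
             (sum-zero λ j → reflexive (≡.cong (λ z → ⟦ ∪-adj G H (inj₂ i) z ⟧ (v (m ↑ʳ i) - v (j ↑ˡ n))) (Fin.splitAt-↑ˡ m j n)))
             (sum-cong-≋ λ j → reflexive (≡.cong (λ z → ⟦ ∪-adj G H (inj₂ i) z ⟧ (v (m ↑ʳ i) - v (m ↑ʳ j))) (Fin.splitAt-↑ʳ m n j))) ⟩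
      0# ⊕ lap H (v ∘ (m ↑ʳ_)) i   ≈⟨ +-identityˡ _ ⟩
      lap H (v ∘ (m ↑ʳ_)) i        ∎

  lap-cong : ∀ {k} (F : Graph k) {v w} → (∀ i → v i ≡ w i) → ∀ i → lap F v i ≈ lap F w i
  lap-cong F v≡w i = sum-cong-≋ λ j → reflexive (≡.cong₂ (λ a b → ⟦ adj F i j ⟧ (a - b)) (v≡w i) (v≡w j))

  lap-constant : ∀ {n} (G : Graph n) x i → lap G (λ _ → x) i ≈ 0#
  lap-constant G x i = sum-zero λ j → vanish (adj G i j)
    where
    vanish : ∀ b → ⟦ b ⟧ (x - x) ≈ 0#
    vanish true  = -‿inverseʳ x
    vanish false = refl

  module _ {m n : ℕ} where

    join : Vector m → Vector n → Vector (m + n)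
    join v w i = [ v , w ]′ (splitAt m i)

    join-↑ˡ : ∀ v w i → join v w (i ↑ˡ n) ≡ v i
    join-↑ˡ v w i = ≡.cong [ v , w ]′ (Fin.splitAt-↑ˡ m i n)

    join-↑ʳ : ∀ v w i → join v w (m ↑ʳ i) ≡ w i
    join-↑ʳ v w i = ≡.cong [ v , w ]′ (Fin.splitAt-↑ʳ m n i)

    sum-join : ∀ v w → sum (join v w) ≈ sum v ⊕ sum w
    sum-join v w = trans (sum-↑ m (join v w))
      (+-cong (sum-cong-≋ (reflexive ∘ join-↑ˡ v w)) (sum-cong-≋ (reflexive ∘ join-↑ʳ v w)))

  module _ {m n} (G : Graph m) (H : Graph n) where

    eigenvector-join : ∀ x v w → (∀ i → lap G v i ≈ x ⊗ v i) → (∀ i → lap H w i ≈ x ⊗ w i) →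
                       ∀ i → lap (G ∪ H) (join v w) i ≈ x ⊗ join v w i
    eigenvector-join x v w Lv Lw = ↑-elim _
      (λ i → trans (lap-∪ˡ G H (join v w) i) (trans (lap-cong G (join-↑ˡ v w) i)
               (trans (Lv i) (*-congˡ (reflexive (≡.sym (join-↑ˡ v w i)))))))
      (λ i → trans (lap-∪ʳ G H (join v w) i) (trans (lap-cong H (join-↑ʳ v w) i)
               (trans (Lw i) (*-congˡ (reflexive (≡.sym (join-↑ʳ v w i)))))))

  -- Spectra on the vectors of coordinate sum zero

  SumZeroEigenvalue : ∀ {n} → Graph n → Carrier → Set _
  SumZeroEigenvalue G x = ∃[ v ] NonZeroVector v × sum v ≈ 0# × (∀ i → lap G v i ≈ x ⊗ v i)

  -- Exhaustiveness is stated contrapositively: a number apart from all of S has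
  -- no eigenvector.  Unlike "x is in S", this passes to unions without having
  -- to decide which part carries the eigenvector.
  record SumZeroSpectrum {n} (G : Graph n) (S : List ℕ) : Set (c ⊔ ℓ₁ ⊔ ℓ₂) where
    field
      bounded     : All (_≤ n) S
      eigenvector : All (SumZeroEigenvalue G ∘ ι) S
      exhaustive  : ∀ x → All (λ s → x # ι s) S → ∀ v → sum v ≈ 0# →
                    (∀ i → lap G v i ≈ x ⊗ v i) → ∀ i → v i ≈ 0#

  open SumZeroSpectrum

  ι-∸ : ∀ {m n} → m ≤ n → ι (n ∸ m) ≈ ι n - ι m
  ι-∸ {m} {n} m≤n = x+y≈z⇒x≈z-y (trans (sym (×-homo-+ 1# (n ∸ m) m)) (×-congˡ (ℕ.m∸n+n≡m m≤n)))

  x-[x-y]≈y : ∀ x y → x - (x - y) ≈ y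
  x-[x-y]≈y x y = begin
    x - (x - y)  ≈⟨ +-congˡ (⁻¹-anti-homo-// x y) ⟩
    x ⊕ (y - x)  ≈⟨ +-comm _ _ ⟩
    y - x ⊕ x    ≈⟨ x-y+y≈x y x ⟩
    y            ∎

  -- Summing the eigenvector equation over all vertices gives `x ⊗ sum v ≈ 0#`, and `x` cancels.
  -- Thus only the eigenvalue 0 can have eigenvectors outside the sum-zero space.
  eigenvector⇒sum≈0 : ∀ {n} (G : Graph n) {x} → x # 0# → ∀ v →
                      (∀ i → lap G v i ≈ x ⊗ v i) → sum v ≈ 0#
  eigenvector⇒sum≈0 G {x} x#0 v Lv≈xv = x#y∧xz≈yz⇒z≈0 x#0 (begin
    x ⊗ sum v              ≈⟨ *-distribˡ-sum x v ⟩
    sum (λ i → x ⊗ v i)    ≈⟨ sum-cong-≋ Lv≈xv ⟨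
    sum (lap G v)          ≈⟨ sum-lap G v ⟩
    0#                     ≈⟨ zeroˡ _ ⟨
    0# ⊗ sum v             ∎)

  module _ {n} (G : Graph n) (v : Vector n) (v≈0 : sum v ≈ 0#) {y : Carrier} where

    private
      lap-sumZero : ∀ i → lap (complement G) v i ⊕ lap G v i ≈ ι n ⊗ v i
      lap-sumZero i = trans (trans (sym (+-identityʳ _)) (+-congˡ (sym v≈0))) (lap-complement G v i)

      -- The relation between the two Laplacians is symmetric, so one computation serves both
      -- directions of complementation.
      difference : ∀ {a b z} → a ⊕ b ≈ ι n ⊗ z → b ≈ y ⊗ z → a ≈ (ι n - y) ⊗ z
      difference {z = z} eq b≈ = trans (x+y≈z⇒x≈z-y (trans (+-congˡ (sym b≈)) eq)) (sym ([y-z]x≈yx-zx z (ι n) y))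

    eigenvector-complement⁺ : (∀ i → lap G v i ≈ y ⊗ v i) →
                              ∀ i → lap (complement G) v i ≈ (ι n - y) ⊗ v i
    eigenvector-complement⁺ Lv≈yv i = difference (lap-sumZero i) (Lv≈yv i)

    eigenvector-complement⁻ : (∀ i → lap (complement G) v i ≈ y ⊗ v i) →
                              ∀ i → lap G v i ≈ (ι n - y) ⊗ v i
    eigenvector-complement⁻ Lv≈yv i = difference (trans (+-comm _ _) (lap-sumZero i)) (Lv≈yv i)

  -- The bound `s ≤ n` makes truncated subtraction agree with subtraction in the field. For
  -- exhaustiveness, an eigenvector for `x` is carried back to one of `G` for `ι n - x`, which is
  -- apart from all of `S`.
  complement-spectrum : ∀ {n} {G : Graph n} {S} → SumZeroSpectrum G S →
                        SumZeroSpectrum (complement G) (map (n ∸_) S)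
  complement-spectrum {n} {G} {S} spec .bounded = All.map⁺ (All.universal (ℕ.m∸n≤m n) S)
  complement-spectrum {n} {G} {S} spec .eigenvector =
    All.map⁺ (All.zipWith (λ (s≤n , v , v#0 , sum≈0 , Lv) →
        v , v#0 , sum≈0 , λ i → trans (eigenvector-complement⁺ G v sum≈0 Lv i) (*-congʳ (sym (ι-∸ s≤n))))
      (spec .bounded , spec .eigenvector))
  complement-spectrum {n} {G} {S} spec .exhaustive x x# v sum≈0 Lv =
    spec .exhaustive (ι n - x) (All.zipWith apart (spec .bounded , All.map⁻ x#)) v sum≈0
      (eigenvector-complement⁻ G v sum≈0 Lv)
    where
    apart : ∀ {s} → s ≤ n × x # ι (n ∸ s) → ι n - x # ι s
    apart {s} (s≤n , x#) = #-sym (#-congʳ (x-[x-y]≈y (ι n) (ι s)) (x#y⇒z-y#z-x (ι n) (#-congˡ (ι-∸ s≤n) x#)))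

  -- Spectra of cliques, unions and `C` in characteristic zero

  module _ (char0 : CharacteristicZero) where

    ι#0 : ∀ {n} → 1 ≤ n → ι n # 0#
    ι#0 (s≤s {n = n} _) = char0 n

    <⇒ι# : ∀ {m n} → m < n → ι n # ι m
    <⇒ι# m<n = x-y#0⇒x#y (#-congʳ (ι-∸ (ℕ.<⇒≤ m<n)) (ι#0 (ℕ.m<n⇒0<n∸m m<n)))

    ≢⇒ι# : ∀ {m n} → m ≢ n → ι m # ι n
    ≢⇒ι# {m} {n} m≢n with ℕ.<-cmp m n
    ... | tri< m<n _ _ = #-sym (<⇒ι# m<n)
    ... | tri≈ _ m≡n _ = contradiction m≡n m≢n
    ... | tri> _ _ n<m = <⇒ι# n<m

    -- On sum-zero vectors the Laplacian of a clique is multiplication by `n`.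
    complete-spectrum : ∀ {n} → 1 ≤ n → SumZeroSpectrum (complete n) (cliqueEigenvalues n)
    complete-spectrum {suc zero} _ = record
      { bounded     = []
      ; eigenvector = []
      ; exhaustive  = λ { x _ v sum≈0 _ zero → trans (sym (+-identityʳ _)) sum≈0 }
      }
    complete-spectrum {n@(suc (suc n′))} _ = record
      { bounded     = ℕ.≤-refl ∷ []
      ; eigenvector = (v , (zero , 1#0) , sum≈0 , lap-sumZero v sum≈0) ∷ []
      ; exhaustive  = λ { x (x#n ∷ []) w w≈0 Lw i →
          x#y∧xz≈yz⇒z≈0 x#n (trans (sym (Lw i)) (lap-sumZero w w≈0 i)) }
      }
      where
      lap-sumZero : ∀ w → sum w ≈ 0# → ∀ i → lap (complete n) w i ≈ ι n ⊗ w i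
      lap-sumZero w w≈0 i = trans (trans (sym (+-identityʳ _)) (+-congˡ (sym w≈0))) (lap-complete w i)

      v : Vector n
      v zero          = 1#
      v (suc zero)    = - 1#
      v (suc (suc _)) = 0#

      sum≈0 : sum v ≈ 0#
      sum≈0 = trans (+-congˡ (trans (+-congˡ (sum-replicate-zero n′)) (+-identityʳ _))) (-‿inverseʳ 1#)

    module _ {m n} {G : Graph m} {H : Graph n} where

      -- Eigenvectors of either part extend by zero; the additional 0 comes from a vector that is
      -- constant on each part.
      ∪-spectrum : ∀ {S T} → 1 ≤ m → 1 ≤ n → SumZeroSpectrum G S → SumZeroSpectrum H T →
                   SumZeroSpectrum (G ∪ H) (0 ∷ S ++ T)
      ∪-spectrum m≥1 n≥1 specG specH .bounded =
        z≤n ∷ All.++⁺ (All.map (λ s≤m → ℕ.≤-trans s≤m (ℕ.m≤m+n m n)) (specG .bounded))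
                      (All.map (λ t≤n → ℕ.≤-trans t≤n (ℕ.m≤n+m n m)) (specH .bounded))
      ∪-spectrum (s≤s _) n≥1 specG specH .eigenvector =
        balanced ∷ All.++⁺ (All.map left (specG .eigenvector)) (All.map right (specH .eigenvector))
        where
        constant : ∀ {k} (F : Graph k) x i → lap F (λ _ → x) i ≈ 0# ⊗ x
        constant F x i = trans (lap-constant F x i) (sym (zeroˡ x))

        zero-vector : ∀ {k} (F : Graph k) x i → lap F (λ _ → 0#) i ≈ x ⊗ 0#
        zero-vector F x i = trans (lap-constant F 0# i) (sym (zeroʳ x))

        balanced : SumZeroEigenvalue (G ∪ H) 0#
        balanced = join v w , (zero , ι#0 n≥1) , sum≈0 ,
                   eigenvector-join G H 0# v w (constant G _) (constant H _)
          where
          -- Each part's constant is, up to sign, the order of the other part, so the two totals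
          -- cancel. Characteristic zero makes the vector nonzero.
          v : Vector m
          v _ = ι n

          w : Vector n
          w _ = - ι m

          sum≈0 : sum (join v w) ≈ 0#
          sum≈0 = begin
            sum (join v w)                ≈⟨ sum-join v w ⟩
            sum v ⊕ sum w                 ≈⟨ +-cong (sum-constant m _) (sum-constant n _) ⟩
            ι m ⊗ ι n ⊕ ι n ⊗ - ι m       ≈⟨ +-congˡ (-‿distribʳ-* (ι n) (ι m)) ⟨
            ι m ⊗ ι n - ι n ⊗ ι m         ≈⟨ x≈y⇒x∙y⁻¹≈ε (*-comm (ι m) (ι n)) ⟩
            0#                            ∎

        left : ∀ {x} → SumZeroEigenvalue G x → SumZeroEigenvalue (G ∪ H) x
        left {x} (v , (i , vi#0) , sum≈0 , Lv) = join v w ,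
          (i ↑ˡ n , #-congʳ (reflexive (≡.sym (join-↑ˡ v w i))) vi#0) ,
          trans (sum-join v w) (trans (+-cong sum≈0 (sum-replicate-zero n)) (+-identityˡ 0#)) ,
          eigenvector-join G H x v w Lv (zero-vector H x)
          where
          w : Vector n
          w _ = 0#

        right : ∀ {x} → SumZeroEigenvalue H x → SumZeroEigenvalue (G ∪ H) x
        right {x} (w , (i , wi#0) , sum≈0 , Lw) = join v w ,
          (m ↑ʳ i , #-congʳ (reflexive (≡.sym (join-↑ʳ v w i))) wi#0) ,
          trans (sum-join v w) (trans (+-cong (sum-replicate-zero m) sum≈0) (+-identityˡ 0#)) ,
          eigenvector-join G H x v w (zero-vector G x) Lw
          where
          v : Vector m
          v _ = 0#
      -- Apartness from the leading 0 makes the restriction of `v` to each part sum to zero, so both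
      -- given spectra apply.
      ∪-spectrum {S} m≥1 n≥1 specG specH .exhaustive x (x#0 ∷ x#) v _ Lv = ↑-elim _
        (specG .exhaustive x (All.++⁻ˡ S x#) _ (eigenvector⇒sum≈0 G x#0 _ Lvˡ) Lvˡ)
        (specH .exhaustive x (All.++⁻ʳ S x#) _ (eigenvector⇒sum≈0 H x#0 _ Lvʳ) Lvʳ)
        where
        Lvˡ : ∀ i → lap G (v ∘ (_↑ˡ n)) i ≈ x ⊗ v (i ↑ˡ n)
        Lvˡ i = trans (sym (lap-∪ˡ G H v i)) (Lv (i ↑ˡ n))

        Lvʳ : ∀ i → lap H (v ∘ (m ↑ʳ_)) i ≈ x ⊗ v (m ↑ʳ i)
        Lvʳ i = trans (sym (lap-∪ʳ G H v i)) (Lv (m ↑ʳ i))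

    C-spectrum : ∀ k (α : Fin (suc k) → ℕ) → (∀ i → 1 ≤ α i) →
                 SumZeroSpectrum (C (suc k) α) (eigenvalues (suc k) α)
    C-spectrum zero    α α≥1 = complement-spectrum (complete-spectrum (α≥1 zero))
    C-spectrum (suc k) α α≥1 = complement-spectrum
      (∪-spectrum (order-positive k (α ∘ inject₁) (α≥1 ∘ inject₁)) (α≥1 (fromℕ (suc k)))
        (C-spectrum k (α ∘ inject₁) (α≥1 ∘ inject₁)) (complete-spectrum (α≥1 (fromℕ (suc k)))))

    -- From sum-zero spectra to the count of distinct eigenvalues

    apart-or-≡ : ∀ {x d e} → x # ι e → (d ≢ e → x # ι d) → x # ι d
    apart-or-≡ {d = d} {e} x#e p with d ℕ.≟ e
    ... | yes ≡.refl = x#e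
    ... | no  d≢e    = p d≢e

    -- By cotransitivity x is apart from at least one of any two distinct members.
    apart-from-all-but-one : ∀ x {D} → Unique D →
      All (λ d → x # ι d) D ⊎ ∃[ e ] e ∈ D × All (λ d → d ≢ e → x # ι d) D
    apart-from-all-but-one x [] = inj₁ []
    apart-from-all-but-one x {d ∷ _} (d∉ ∷ D!) with apart-from-all-but-one x D!
    ... | inj₁ x# = inj₂ (d , here ≡.refl , (λ d≢d → contradiction ≡.refl d≢d) ∷ All.map (λ p _ → p) x#)
    ... | inj₂ (e , e∈ , x#) with #-cotrans (≢⇒ι# (All.lookup d∉ e∈)) x
    ...   | inj₁ d#x = inj₂ (e , there e∈ , (λ _ → #-sym d#x) ∷ x#)
    ...   | inj₂ x#e = inj₂ (d , here ≡.refl , (λ d≢d → contradiction ≡.refl d≢d) ∷ All.map (λ p _ → apart-or-≡ x#e p) x#)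

    -- Only one candidate `e` is left. Were `x` apart from it too, `x` would be apart from all of
    -- `D`, so tightness gives `x ≈ ι e`.
    not-apart⇒∈ : ∀ x {D} → Unique D → ¬ All (λ d → x # ι d) D → ∃[ e ] e ∈ D × x ≈ ι e
    not-apart⇒∈ x D! ¬x# with apart-from-all-but-one x D!
    ... | inj₁ x# = contradiction x# ¬x#
    ... | inj₂ (e , e∈ , x#) = e , e∈ , proj₁ (tight x (ι e)) λ x#e → ¬x# (All.map (apart-or-≡ x#e) x#)

    -- The constant vector adds the eigenvalue 0 to the sum-zero spectrum. As `S` may repeat values
    -- or contain 0 already, duplicates are removed before counting.
    distinctEigenvalues : ∀ {n} {G : Graph n} {S} → 1 ≤ n → SumZeroSpectrum G S →
      DistinctEigenvalues (laplacian G) (length (deduplicate ℕ._≟_ (0 ∷ S)))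
    distinctEigenvalues {n} {G} {S} n≥1 spec = record
      { eigenvalue   = ι ∘ lookup D
      ; isEigenvalue = λ i → All.lookup all-eigenvalues (∈-deduplicate⁻ ℕ._≟_ (0 ∷ S) (∈-lookup i))
      ; distinct     = λ i j i≢j → ≢⇒ι# (i≢j ∘ lookup-injective D! i j)
      ; exhaustive   = λ x x-eigen → let e , e∈ , x≈e = not-apart⇒∈ x D! (not-apart x x-eigen) in
          index e∈ , trans x≈e (×-congˡ (lookup-index e∈))
      }
      where
      D : List ℕ
      D = deduplicate ℕ._≟_ (0 ∷ S)

      D! : Unique D
      D! = deduplicate-! ℕ._≟_ (0 ∷ S)

      all-eigenvalues : All (IsEigenvalue (laplacian G) ∘ ι) (0 ∷ S)
      all-eigenvalues =
        ((λ _ → 1#) , constant-nonzero n≥1 , λ i → trans (laplacian≈lap G _ i) (trans (lap-constant G 1# i) (sym (zeroˡ 1#))))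
        ∷ All.map (λ (v , v#0 , _ , Lv) → v , v#0 , λ i → trans (laplacian≈lap G v i) (Lv i)) (spec .eigenvector)
        where
        constant-nonzero : ∀ {n} → 1 ≤ n → NonZeroVector {n} (λ _ → 1#)
        constant-nonzero (s≤s _) = zero , 1#0

      not-apart : ∀ x → IsEigenvalue (laplacian G) x → ¬ All (λ d → x # ι d) D
      not-apart x (v , (i , vi#0) , Lv) x#D with All-resp-⊇ (∈-deduplicate⁺ ℕ._≟_) x#D
      -- Since `x` is apart from 0, the eigenvector has sum zero; exhaustiveness then makes its
      -- nonzero coordinate vanish.
      ... | x#0 ∷ x#S = #-irrefl (spec .exhaustive x x#S v (eigenvector⇒sum≈0 G x#0 v Lv′) Lv′ i) vi#0
        where
        Lv′ : ∀ i → lap G v i ≈ x ⊗ v i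
        Lv′ i = trans (sym (laplacian≈lap G v i)) (Lv i)

theorem3p1 : ∀ {c ℓ₁ ℓ₂} (K : HeytingField c ℓ₁ ℓ₂) → Spectrum.CharacteristicZero K →
    (k : ℕ) → 2 ≤ k → 2 ∣ k →
    (α : Fin k → ℕ) → (∀ i → 1 ≤ α i) →
    ∃[ m ] (Spectrum.DistinctEigenvalues K (Spectrum.laplacian K (C k α)) m × k ≤ m × m ≤ 2 * k ∸ 1)
theorem3p1 K char0 (suc k) _ _ α α≥1 =
  length D , distinctEigenvalues K char0 (order-positive k α α≥1) (C-spectrum K char0 k α α≥1) ,
  -- The lower list has `suc k` distinct entries, all in `D`; conversely `D` is duplicate-free and
  -- lies in the upper list.
  ≡.subst (_≤ length D) (length-lowerEigenvalues k α)
    (unique-⊆⇒length≤ (lowerEigenvalues-unique k α α≥1) (∈-deduplicate⁺ ℕ._≟_ ∘ lowerEigenvalues-⊆ k α)) ,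
  ≡.subst (length D ≤_) (length-upperEigenvalues k α)
    (unique-⊆⇒length≤ (deduplicate-! ℕ._≟_ (0 ∷ eigenvalues (suc k) α)) (⊆-upperEigenvalues k α ∘ ∈-deduplicate⁻ ℕ._≟_ _))
  where
  D : List ℕ
  D = deduplicate ℕ._≟_ (0 ∷ eigenvalues (suc k) α)
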